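{- For every $\mathsf{u}\in\mathcal{A}$, the set of equitable partitions of $\mathsf{u}$ forms a distributive lattice under the componentwise order. Its minimal element is the leftmost equitable partition of $\mathsf{u}$ and its maximal element is the rightmost equitable partition of $\mathsf{u}$.
   Context: Fix positive integers $m,N$. Let $\mathcal{A}$ be the set of words $\mathsf{u}=\mathsf{u}_1\cdots\mathsf{u}_N$ of length $N$ over $\{0,1,\ldots,m-1\}$; write $|\mathsf{u}|=\sum_i\mathsf{u}_i$ and $|\mathsf{u}|_m=|\mathsf{u}|\bmod m$. A partitioned word of $\mathsf{u}$ is a decomposition $\mathsf{u}^*=\mathsf{u}^*_{m-1}|\cdots|\mathsf{u}^*_0$ of $\mathsf{u}$ into $m$ possibly empty consecutive factors (blocks) whose concatenation is $\mathsf{u}$ (block $m-1$ leftmost, block $0$ rightmost); $\mathsf{block}(\mathsf{u}^*,i)=k$ if $\mathsf{u}_i$ lies in $\mathsf{u}^*_k$. The balancing array of $\mathsf{u}^*$ is the $N\times m$ array (rows $i=1..N$, columns $j=m-1,\ldots,0$) whose entry $(i,j)$ is filled iff $j\equiv\mathsf{block}(\mathsf{u}^*,i)-t\pmod m$ for some $0\le t\le\mathsf{u}_i-1$. Column $j$ is equitably filled if it has exactly $\lfloor|\mathsf{u}|/m\rfloor+1$ filled entries when $1\le j\le|\mathsf{u}|_m$ and exactly $\lfloor|\mathsf{u}|/m\rfloor$ when $j=0$ or $j>|\mathsf{u}|_m$; $\mathsf{u}^*$ is an equitable partition if all columns are equitably filled. The componentwise order: $\mathsf{u}^*\le\mathsf{v}^*$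 iff $\mathsf{block}(\mathsf{u}^*,i)\ge\mathsf{block}(\mathsf{v}^*,i)$ for all $i$. The leftmost (resp. rightmost) equitable partition of $\mathsf{u}$ is the equitable partition $\mathsf{u}^*$ such that every equitable partition $\mathsf{v}^*$ of $\mathsf{u}$ satisfies $\mathsf{block}(\mathsf{v}^*,i)\le\mathsf{block}(\mathsf{u}^*,i)$ (resp. $\ge$) for all $i$; both exist and are unique. -}

module Defs where

open import Data.Nat using (ℕ; zero; suc; _+_; _∸_; _≤_; _≡ᵇ_; NonZero)
open import Data.Nat.DivMod using (_/_; _%_)
open import Data.Fin using (Fin; toℕ) renaming (_≤_ to _≤ᶠ_)
open import Data.List using (List; map; upTo; allFin)
open import Data.Nat.ListAction using (sum)
open import Data.Bool.ListAction using (any)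
open import Data.Bool using (Bool; if_then_else_)
open import Data.Product using (Σ; _×_; proj₁)
open import Relation.Binary.PropositionalEquality using (_≡_)
open import Relation.Nullary using (¬_)

Word : ℕ → ℕ → Set
Word m N = Fin N → Fin m

weight : ∀ {m N} → Word m N → ℕ
weight {N = N} u = sum (map (λ i → toℕ (u i)) (allFin N))

-- A partitioned word u* of u into m consecutive (possibly empty) blocks
-- u*_{m-1} | ⋯ | u*_0 is determined by its block function
-- i ↦ block(u*, i) ∈ Fin m, which must be weakly decreasing in i
-- (block m-1 leftmost, block 0 rightmost).
Blocks : ℕ → ℕ → Set
Blocks m N = Fin N → Fin m

IsPartitionedWord : ∀ {m N} → Blocks m N → Set
IsPartitionedWord b = ∀ i i′ → i ≤ᶠ i′ → b i′ ≤ᶠ b i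

-- Entry (i , j) of the balancing array is filled iff
-- j ≡ block(u*,i) - t (mod m) for some 0 ≤ t ≤ u_i - 1.
filled : ∀ {m N} .{{_ : NonZero m}} → Word m N → Blocks m N → Fin N → Fin m → Bool
filled {m} u b i j =
  any (λ t → ((toℕ (b i) + m ∸ t) % m) ≡ᵇ toℕ j) (upTo (toℕ (u i)))

columnCount : ∀ {m N} .{{_ : NonZero m}} → Word m N → Blocks m N → Fin m → ℕ
columnCount {N = N} u b j =
  sum (map (λ i → if filled u b i j then 1 else 0) (allFin N))

EquitablyFilled : ∀ {m N} .{{_ : NonZero m}} → Word m N → Blocks m N → Fin m → Set
EquitablyFilled {m} u b j =
  ((1 ≤ toℕ j × toℕ j ≤ weight u % m) → columnCount u b j ≡ suc (weight u / m)) ×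
  (¬ (1 ≤ toℕ j × toℕ j ≤ weight u % m) → columnCount u b j ≡ weight u / m)

IsEquitablePartition : ∀ {m N} .{{_ : NonZero m}} → Word m N → Blocks m N → Set
IsEquitablePartition u b = IsPartitionedWord b × (∀ j → EquitablyFilled u b j)

EqPart : ∀ {m N} .{{_ : NonZero m}} → Word m N → Set
EqPart {m} {N} u = Σ (Blocks m N) (IsEquitablePartition u)

block : ∀ {m N} .{{_ : NonZero m}} {u : Word m N} → EqPart u → Fin N → Fin m
block e = proj₁ e

_≈ₚ_ : ∀ {m N} .{{_ : NonZero m}} {u : Word m N} → EqPart u → EqPart u → Set
e ≈ₚ f = ∀ i → block e i ≡ block f i

_≼_ : ∀ {m N} .{{_ : NonZero m}} {u : Word m N} → EqPart u → EqPart u → Set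
e ≼ f = ∀ i → block f i ≤ᶠ block e i

IsLeftmost : ∀ {m N} .{{_ : NonZero m}} (u : Word m N) → EqPart u → Set
IsLeftmost u e = ∀ (v : EqPart u) i → block v i ≤ᶠ block e i

IsRightmost : ∀ {m N} .{{_ : NonZero m}} (u : Word m N) → EqPart u → Set
IsRightmost u e = ∀ (v : EqPart u) i → block e i ≤ᶠ block v i

{-# OPTIONS --safe #-}
-- The lattice operations are the pointwise minimum and maximum of the block
-- functions. For equitable b, e and a column j, the sets {i : b i ≥ j} and
-- {i : e i ≥ j} are nested initial segments; comparing the maximum with the one
-- of b, e that has the larger segment shows that no column of the maximum is
-- fuller than prescribed, dually no column of the minimum is emptier, and the
-- column counts always add up to |u|.
--
-- Existence comes from the modular sweep map. A word w is read as a path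
-- descending from |w| to 0; its steps are sorted by decreasing level mod m, ties
-- in order of time, which gives a word u with a block function. This partition is
-- equitable because the path covers each of 1 , … , |w| exactly once. Following
-- the path backwards shows that no equitable partition of u lies strictly below
-- it (in terms of blocks), so by closure under minima it is the rightmost one. It
-- is therefore determined by u, and so are the path and w: the sweep map is an
-- injective, hence surjective, self-map of the finite set of words, and every u
-- has a rightmost equitable partition. The leftmost one is a finite maximum.
module Submission where

open import Defs
open import Data.Nat using (ℕ; NonZero)
open import Data.Product using (Σ; _×_)
open import Algebra.Core using (Op₂)
open import Relation.Binary.Definitions using (Minimum; Maximum)
open import Relation.Binary.Lattice.Structures using (IsDistributiveLattice)

open import Data.Nat
  using (zero; suc; _+_; _*_; _∸_; _^_; _≤_; _<_; _≤?_; _<?_; _<ᵇ_; _≡ᵇ_; z≤n; s≤s; z<s; s≤s⁻¹)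
open import Data.Nat.Properties
open import Data.Nat.DivMod
open import Data.Nat.Divisibility using (n∣m*n)
open import Data.Fin using (Fin; zero; suc; toℕ; fromℕ<; combine; opposite; punchOut; finToFun; funToFin)
open import Data.Fin.Induction using (<-wellFounded; >-wellFounded)
open import Data.Fin.Permutation using (Permutation′; permutation)
open import Data.Bool using (Bool; true; false; T; if_then_else_)
open import Data.Bool.ListAction using (any)
open import Data.List using (upTo; allFin)
import Data.List as List
import Data.List.Properties as List
import Data.Nat.ListAction as ListAction
open import Data.List.Membership.Propositional using (find; lose)
open import Data.List.Membership.Propositional.Properties using (∈-upTo⁺; ∈-upTo⁻)
open import Data.List.Relation.Unary.Any.Properties using (any⁺; any⁻)
open import Data.Fin.Properties using (toℕ<n; toℕ-injective; toℕ-fromℕ<; any?; all?)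
import Data.Fin.Properties as Fin
import Algebra.Construct.NaturalChoice.Min as Min
import Algebra.Construct.NaturalChoice.Max as Max
import Algebra.Construct.NaturalChoice.MinMaxOp as MinMaxOp
open import Data.Product using (∃; _,_; proj₁; proj₂)
open import Data.Sum using (_⊎_; inj₁; inj₂; [_,_]′)
open import Data.Unit using (tt)
open import Function using (_∘_; id; Injective)
open import Induction.WellFounded using (Acc; acc)
open import Relation.Nullary using (¬_; Dec; yes; no; ¬?; contradiction; _×-dec_; _→-dec_)
open import Relation.Binary.Definitions using (tri<; tri≈; tri>)
open import Relation.Binary.PropositionalEquality
open import Algebra.Properties.CommutativeMonoid.Sum +-0-commutativeMonoid
  using (sum; sum-cong-≗; ∑-distrib-+; ∑-comm; sum-permute)

-- Indicators and finite sums

⟦_⟧ : Bool → ℕ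
⟦ b ⟧ = if b then 1 else 0

⟦⟧-true : ∀ {b} → T b → ⟦ b ⟧ ≡ 1
⟦⟧-true {true} _ = refl

⟦⟧-false : ∀ {b} → ¬ T b → ⟦ b ⟧ ≡ 0
⟦⟧-false {true}  ¬b = contradiction tt ¬b
⟦⟧-false {false} _  = refl

⟦⟧-mono : ∀ {b c} → (T b → T c) → ⟦ b ⟧ ≤ ⟦ c ⟧
⟦⟧-mono {true}  {true}  _   = ≤-refl
⟦⟧-mono {true}  {false} b⇒c = contradiction (b⇒c tt) λ()
⟦⟧-mono {false}         _   = z≤n

⟦⟧-reflects : ∀ {b c} → ⟦ b ⟧ ≡ ⟦ c ⟧ → T c → T b
⟦⟧-reflects {true}          _ _ = tt
⟦⟧-reflects {false} {true} () _

sum-list≡sum : ∀ {n} (f : Fin n → ℕ) → ListAction.sum (List.map f (allFin n)) ≡ sum f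
sum-list≡sum f = trans (cong ListAction.sum (List.map-tabulate id f)) (sum-tabulate f)
  where
  sum-tabulate : ∀ {n} (f : Fin n → ℕ) → ListAction.sum (List.tabulate f) ≡ sum f
  sum-tabulate {zero}  f = refl
  sum-tabulate {suc n} f = cong (f zero +_) (sum-tabulate (f ∘ suc))

sum-mono-≤ : ∀ {n} {f g : Fin n → ℕ} → (∀ i → f i ≤ g i) → sum f ≤ sum g
sum-mono-≤ {zero}  f≤g = z≤n
sum-mono-≤ {suc n} f≤g = +-mono-≤ (f≤g zero) (sum-mono-≤ (f≤g ∘ suc))

sum-mono-< : ∀ {n} {f g : Fin n → ℕ} → (∀ i → f i ≤ g i) → ∀ i → f i < g i → sum f < sum g
sum-mono-< f≤g zero    fi<gi = +-mono-<-≤ fi<gi (sum-mono-≤ (f≤g ∘ suc))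
sum-mono-< f≤g (suc i) fi<gi = +-mono-≤-< (f≤g zero) (sum-mono-< (f≤g ∘ suc) i fi<gi)

≤∧sum≡⇒≗ : ∀ {n} {f g : Fin n → ℕ} → (∀ i → f i ≤ g i) → sum f ≡ sum g → f ≗ g
≤∧sum≡⇒≗ f≤g Σf≡Σg i =
  ≤-antisym (f≤g i) (≮⇒≥ λ fi<gi → <-irrefl Σf≡Σg (sum-mono-< f≤g i fi<gi))

-- Cyclic intervals of columns

-- Columns j with x ∸ a < j ≤ x, read cyclically in {0 , … , m - 1}: the second
-- alternative is the part that wraps around below 0.
Covers : ℕ → ℕ → ℕ → ℕ → Set
Covers m x a j = (j ≤ x × x < j + a) ⊎ (x < j × x + m < j + a)

-- Lowering the start of the interval from `x` to `y` shortens the way down to every column outside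
-- `(y , x]`, so such a column stays covered.
Covers-shift : ∀ {m x y a j} → y ≤ x → ¬ (y < j × j ≤ x) → Covers m x a j → Covers m y a j
Covers-shift y≤x ¬between (inj₁ (j≤x , x<j+a)) =
  inj₁ (≮⇒≥ (λ y<j → ¬between (y<j , j≤x)) , ≤-<-trans y≤x x<j+a)
Covers-shift y≤x _ (inj₂ (x<j , x+m<j+a)) =
  inj₂ (≤-<-trans y≤x x<j , ≤-<-trans (+-monoˡ-≤ _ y≤x) x+m<j+a)

module _ (m : ℕ) .{{_ : NonZero m}} where

  -- The test of `filled` for a letter `a` in block `x`, as a function of numbers.
  covered : ℕ → ℕ → ℕ → Bool
  covered x a j = any (λ t → ((x + m ∸ t) % m) ≡ᵇ j) (upTo a)

  n<m+m⇒n%m : ∀ {y x} → x < m → y ≡ x + m → y % m ≡ x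
  n<m+m⇒n%m {x = x} x<m refl = trans ([m+n]%n≡m%n x m) (m<n⇒m%n≡m x<m)

  covered⇒Covers : ∀ {x a j} → x < m → a < m → T (covered x a j) → Covers m x a j
  covered⇒Covers {x} {a} {j} x<m a<m c
    with t , t∈ , eq ← find (any⁻ _ (upTo a) c)
    with y ← x + m ∸ t in y-def
    with y+t≡x+m ← trans (cong (_+ t) (sym y-def))
           (m∸n+n≡m {x + m} {t} (≤-trans (<⇒≤ (<-trans (∈-upTo⁻ t∈) a<m)) (m≤n+m m x)))
    with y%m≡j ← ≡ᵇ⇒≡ _ j eq
    with t<a ← ∈-upTo⁻ t∈
    -- Going down `t` from `x` passes below column 0 exactly when `y = x + m - t` is less than `m`.
    with y <? m
  ... | yes y<m with refl ← trans (sym (m<n⇒m%n≡m y<m)) y%m≡j =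
    inj₂ ( +-cancelʳ-< m x y (subst (_< y + m) y+t≡x+m (+-monoʳ-< y (<-trans t<a a<m)))
         , subst (_< y + a) y+t≡x+m (+-monoʳ-< y t<a))
  ... | no y≮m = inj₁ (subst (j ≤_) z+t≡x (subst (_≤ (y ∸ m) + t) z≡j (m≤m+n _ t))
                      , subst₂ _<_ z+t≡x (cong (_+ a) z≡j) (+-monoʳ-< (y ∸ m) t<a))
    where
    z+m≡y : (y ∸ m) + m ≡ y
    z+m≡y = m∸n+n≡m (≮⇒≥ y≮m)
    z+t≡x : (y ∸ m) + t ≡ x
    z+t≡x = +-cancelʳ-≡ m _ x (begin
      (y ∸ m) + t + m   ≡⟨ +-assoc (y ∸ m) t m ⟩
      (y ∸ m) + (t + m) ≡⟨ cong ((y ∸ m) +_) (+-comm t m) ⟩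
      (y ∸ m) + (m + t) ≡⟨ +-assoc (y ∸ m) m t ⟨
      (y ∸ m) + m + t   ≡⟨ cong (_+ t) z+m≡y ⟩
      y + t             ≡⟨ y+t≡x+m ⟩
      x + m             ∎)
      where open ≡-Reasoning
    z≡j : y ∸ m ≡ j
    z≡j = trans (sym (n<m+m⇒n%m (≤-<-trans (subst (y ∸ m ≤_) z+t≡x (m≤m+n _ t)) x<m) (sym z+m≡y))) y%m≡j

  Covers⇒covered : ∀ {x a j} → x < m → j < m → Covers m x a j → T (covered x a j)
  Covers⇒covered {x} {a} {j} x<m j<m c = 
    let t , t<a , eq = go c in any⁺ _ (lose (∈-upTo⁺ t<a) (≡⇒≡ᵇ _ j eq))
    where
    go : Covers m x a j → ∃ λ t → t < a × (x + m ∸ t) % m ≡ j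
    go (inj₁ (j≤x , x<j+a)) =
      x ∸ j
      , +-cancelˡ-< j _ a (subst (_< j + a) (sym (m+[n∸m]≡n j≤x)) x<j+a)
      , n<m+m⇒n%m j<m (begin
          x + m ∸ (x ∸ j)               ≡⟨ cong (λ z → z + m ∸ (x ∸ j)) (m∸n+n≡m j≤x) ⟨
          (x ∸ j) + j + m ∸ (x ∸ j)     ≡⟨ cong (_∸ (x ∸ j)) (+-assoc (x ∸ j) j m) ⟩
          (x ∸ j) + (j + m) ∸ (x ∸ j)   ≡⟨ m+n∸m≡n (x ∸ j) (j + m) ⟩
          j + m                         ∎)
      where open ≡-Reasoning
    go (inj₂ (x<j , x+m<j+a)) =
      x + m ∸ j
      , +-cancelˡ-< j _ a (subst (_< j + a) (sym (m+[n∸m]≡n j≤x+m)) x+m<j+a)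
      , trans (cong (_% m) (m∸[m∸n]≡n j≤x+m)) (m<n⇒m%n≡m j<m)
      where
      j≤x+m : j ≤ x + m
      j≤x+m = ≤-trans (<⇒≤ j<m) (m≤n+m m x)

-- Prescribed column fillings

-- The prescribed filling of column j when |u| = r + q m with r < m.
quota : ℕ → ℕ → ℕ → ℕ
quota q r zero    = q
quota q r (suc j) = if j <ᵇ r then suc q else q

quota-in : ∀ {q r j} → 1 ≤ j → j ≤ r → quota q r j ≡ suc q
quota-in {q} {r} {suc j} _ j<r with j <ᵇ r | <⇒<ᵇ j<r
... | true | _ = refl

quota-out : ∀ {q r j} → ¬ (1 ≤ j × j ≤ r) → quota q r j ≡ q
quota-out {j = zero} _ = refl
quota-out {q} {r} {suc j} ¬in with j <ᵇ r in eq
... | true  = contradiction (s≤s z≤n , <ᵇ⇒< j r (subst T (sym eq) tt)) ¬in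
... | false = refl

sum-quota : ∀ k {q r} → r ≤ k → sum {suc k} (quota q r ∘ toℕ) ≡ r + suc k * q
sum-quota k {q} {r} r≤k = begin
  q + sum {k} (quota q r ∘ suc ∘ toℕ) ≡⟨ cong (q +_) (sum-step k r≤k) ⟩
  q + (r + k * q)                     ≡⟨ x∙yz≈y∙xz q r (k * q) ⟩
  r + (q + k * q)                     ∎
  where
  open ≡-Reasoning
  open import Algebra.Properties.CommutativeSemigroup +-commutativeSemigroup using (x∙yz≈y∙xz)
  sum-step : ∀ k {r} → r ≤ k → sum {k} (λ j → if toℕ j <ᵇ r then suc q else q) ≡ r + k * q
  sum-step zero    z≤n       = refl
  sum-step (suc k) z≤n       = cong (q +_) (sum-step k z≤n)
  sum-step (suc k) (s≤s {r} r≤k) = begin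
    suc q + sum {k} (λ j → if toℕ j <ᵇ r then suc q else q) ≡⟨ cong (suc q +_) (sum-step k r≤k) ⟩
    suc q + (r + k * q)                                     ≡⟨ cong suc (x∙yz≈y∙xz q r (k * q)) ⟩
    suc r + (q + k * q)                                     ∎

module _ {m : ℕ} .{{_ : NonZero m}} where

  -- Without wrapping, the columns that gain an entry are `v + 1 , … , v + a`, the interval of
  -- length `a` going down from `v + a`.
  quota-step : ∀ {v a j} q → a < m → j < m → v + a < m →
               quota q (v + a) j ≡ ⟦ covered m (v + a) a j ⟧ + quota q v j
  quota-step {v} {a} {j} q a<m j<m v+a<m with 1 ≤? j | j ≤? v | j ≤? v + a
  ... | yes 1≤j | yes j≤v | _ =
    trans (quota-in 1≤j (≤-trans j≤v (m≤m+n v a)))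
      (sym (cong₂ _+_ (⟦⟧-false (uncov ∘ covered⇒Covers m v+a<m a<m)) (quota-in 1≤j j≤v)))
    where
    uncov : ¬ Covers m (v + a) a j
    uncov (inj₁ (_ , lt)) = <⇒≱ (+-cancelʳ-< a v j lt) j≤v
    uncov (inj₂ (lt , _)) = <⇒≱ lt (≤-trans j≤v (m≤m+n v a))
  ... | yes 1≤j | no j≰v | yes j≤v+a =
    trans (quota-in 1≤j j≤v+a)
      (sym (cong₂ _+_ (⟦⟧-true (Covers⇒covered m v+a<m j<m (inj₁ (j≤v+a , +-monoˡ-< a (≰⇒> j≰v)))))
        (quota-out (j≰v ∘ proj₂))))
  ... | yes 1≤j | no j≰v | no j≰v+a =
    trans (quota-out (j≰v+a ∘ proj₂))
      (sym (cong₂ _+_ (⟦⟧-false (uncov ∘ covered⇒Covers m v+a<m a<m)) (quota-out (j≰v ∘ proj₂))))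
    where
    uncov : ¬ Covers m (v + a) a j
    uncov (inj₁ (le , _)) = j≰v+a le
    uncov (inj₂ (_ , lt)) = <⇒≱ lt (subst (_≤ v + a + m) (+-comm a j) (+-mono-≤ (m≤n+m a v) (<⇒≤ j<m)))
  ... | no 1≰j | _ | _ =
    trans (quota-out (1≰j ∘ proj₁))
      (sym (cong₂ _+_ (⟦⟧-false (uncov ∘ covered⇒Covers m v+a<m a<m)) (quota-out (1≰j ∘ proj₁))))
    where
    uncov : ¬ Covers m (v + a) a j
    uncov (inj₁ (_ , lt)) = <⇒≱ (+-cancelʳ-< a v j lt) (≤-trans (s≤s⁻¹ (≰⇒> 1≰j)) z≤n)
    uncov (inj₂ (lt , _)) = <⇒≱ lt (≤-trans (s≤s⁻¹ (≰⇒> 1≰j)) z≤n)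

  wrap-<ˡ : ∀ {v a x} → a < m → v + a ≡ x + m → x < v
  wrap-<ˡ {v} {a} {x} a<m v+a≡x+m = +-cancelʳ-< m x v (subst (_< v + m) v+a≡x+m (+-monoʳ-< v a<m))

  wrap-<ʳ : ∀ {v a x} → v < m → v + a ≡ x + m → x < a
  wrap-<ʳ {v} {a} {x} v<m v+a≡x+m = wrap-<ˡ v<m (trans (+-comm a v) v+a≡x+m)

  -- The base filling rises by one, while columns `x + 1 , … , v` lose their extra entry. The gain
  -- is one in columns `v + 1 , … , m - 1 , 0 , … , x`, a cyclic interval of length `a`.
  quota-wrap : ∀ {v a j x} q → v < m → a < m → j < m → x < m → v + a ≡ x + m →
               quota (suc q) x j ≡ ⟦ covered m x a j ⟧ + quota q v j
  quota-wrap {v} {a} {j} {x} q v<m a<m j<m x<m v+a≡x+m with 1 ≤? j | j ≤? x | j ≤? v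
  ... | _ | yes j≤x | no j≰v = contradiction (≤-trans j≤x (<⇒≤ (wrap-<ˡ a<m v+a≡x+m))) j≰v
  ... | yes 1≤j | yes j≤x | yes j≤v =
    trans (quota-in 1≤j j≤x)
      (sym (cong₂ _+_ (⟦⟧-true (Covers⇒covered m x<m j<m (inj₁ (j≤x , <-≤-trans (wrap-<ʳ v<m v+a≡x+m) (m≤n+m a j)))))
        (quota-in 1≤j j≤v)))
  ... | yes 1≤j | no j≰x | yes j≤v =
    trans (quota-out (j≰x ∘ proj₂))
      (sym (cong₂ _+_ (⟦⟧-false (uncov ∘ covered⇒Covers m x<m a<m)) (quota-in 1≤j j≤v)))
    where
    uncov : ¬ Covers m x a j
    uncov (inj₁ (le , _)) = j≰x le
    uncov (inj₂ (_ , lt)) = <⇒≱ (+-cancelʳ-< a v j (subst (_< j + a) (sym v+a≡x+m) lt)) j≤v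
  ... | yes 1≤j | no j≰x | no j≰v =
    trans (quota-out (j≰x ∘ proj₂))
      (sym (cong₂ _+_ (⟦⟧-true (Covers⇒covered m x<m j<m
          (inj₂ (≰⇒> j≰x , subst (_< j + a) v+a≡x+m (+-monoˡ-< a (≰⇒> j≰v))))))
        (quota-out (j≰v ∘ proj₂))))
  ... | no 1≰j | yes j≤x | _ =
    trans (quota-out (1≰j ∘ proj₁))
      (sym (cong₂ _+_ (⟦⟧-true (Covers⇒covered m x<m j<m (inj₁ (j≤x , <-≤-trans (wrap-<ʳ v<m v+a≡x+m) (m≤n+m a j)))))
        (quota-out (1≰j ∘ proj₁))))
  ... | no 1≰j | no j≰x | _ = contradiction (≤-trans (s≤s⁻¹ (≰⇒> 1≰j)) z≤n) j≰x

  -- For `j < m`, this is the number of heights among `1 , … , n` that are congruent to `j` mod `m`.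
  target : ℕ → ℕ → ℕ
  target n = quota (n / m) (n % m)

  [r+qm]%m : ∀ {r} q → r < m → (r + q * m) % m ≡ r
  [r+qm]%m {r} q r<m = trans ([m+kn]%n≡m%n r q m) (m<n⇒m%n≡m r<m)

  target-unique : ∀ {n r} q j → r < m → n ≡ r + q * m → target n j ≡ quota q r j
  target-unique {r = r} q j r<m refl = cong₂ (λ q r → quota q r j) [r+qm]/m ([r+qm]%m q r<m)
    where
    [r+qm]/m : (r + q * m) / m ≡ q
    [r+qm]/m = trans (+-distrib-/-∣ʳ r (n∣m*n q))
                     (cong₂ _+_ (m<n⇒m/n≡0 r<m) (m*n/n≡m q m))

  a+n≡v+a+qm : ∀ a n → a + n ≡ n % m + a + n / m * m
  a+n≡v+a+qm a n = begin
    a + n                       ≡⟨ cong (a +_) (m≡m%n+[m/n]*n n m) ⟩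
    a + (n % m + n / m * m)     ≡⟨ +-assoc a (n % m) _ ⟨
    a + n % m + n / m * m       ≡⟨ cong (_+ n / m * m) (+-comm a (n % m)) ⟩
    n % m + a + n / m * m       ∎
    where open ≡-Reasoning

  [a+n]%m : ∀ {a} n → a < m →
            (n % m + a < m × (a + n) % m ≡ n % m + a) ⊎ (n % m + a ≡ (a + n) % m + m)
  [a+n]%m {a} n a<m with n % m + a <? m
  ... | yes v+a<m = inj₁ (v+a<m , trans (cong (_% m) (a+n≡v+a+qm a n)) ([r+qm]%m (n / m) v+a<m))
  ... | no  v+a≮m = inj₂ (sym (trans (cong (_+ m) eq) (m∸n+n≡m (≮⇒≥ v+a≮m))))
    where
    x : ℕ
    x = n % m + a ∸ m
    x+m≡v+a : x + m ≡ n % m + a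
    x+m≡v+a = m∸n+n≡m (≮⇒≥ v+a≮m)
    x<m : x < m
    x<m = <-trans (wrap-<ˡ a<m (sym x+m≡v+a)) (m%n<n n m)
    open ≡-Reasoning
    eq : (a + n) % m ≡ x
    eq = begin
      (a + n) % m                   ≡⟨ cong (_% m) (a+n≡v+a+qm a n) ⟩
      (n % m + a + n / m * m) % m   ≡⟨ [m+kn]%n≡m%n (n % m + a) (n / m) m ⟩
      (n % m + a) % m               ≡⟨ n<m+m⇒n%m m x<m (sym x+m≡v+a) ⟩
      x                             ∎

  -- A step from `a + n` down to `n` covers the heights `n + 1 , … , a + n`. Whether one of them is
  -- a multiple of `m` decides between `quota-step` and `quota-wrap`.
  target-+ : ∀ {a j} n → a < m → j < m →
             target (a + n) j ≡ ⟦ covered m ((a + n) % m) a j ⟧ + target n j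
  target-+ {a} {j} n a<m j<m with [a+n]%m n a<m
  ... | inj₁ (v+a<m , eq) =
    trans (target-unique (n / m) j v+a<m (a+n≡v+a+qm a n))
      (trans (quota-step (n / m) a<m j<m v+a<m)
             (cong (λ x → ⟦ covered m x a j ⟧ + target n j) (sym eq)))
  ... | inj₂ v+a≡x+m =
    trans (target-unique (suc (n / m)) j (m%n<n (a + n) m) a+n≡x+[1+q]m)
          (quota-wrap (n / m) (m%n<n n m) a<m j<m (m%n<n (a + n) m) v+a≡x+m)
    where
    a+n≡x+[1+q]m : a + n ≡ (a + n) % m + suc (n / m) * m
    a+n≡x+[1+q]m = trans (a+n≡v+a+qm a n)
      (trans (cong (_+ n / m * m) v+a≡x+m) (+-assoc ((a + n) % m) m _))

  sum-target : ∀ n → sum {m} (target n ∘ toℕ) ≡ n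
  sum-target n = trans (sum-quota′ m (m%n<n n m))
    (sym (trans (m≡m%n+[m/n]*n n m) (cong (n % m +_) (*-comm (n / m) m))))
    where
    sum-quota′ : ∀ k {q r} → r < k → sum {k} (quota q r ∘ toℕ) ≡ r + k * q
    sum-quota′ (suc k) r<k = sum-quota k (s≤s⁻¹ r<k)

  -- The interval is the difference of `target (a + n)` and `target n`, whose totals differ by `a`.
  sum-covered : ∀ {x a} → x < m → a < m → sum {m} (λ j → ⟦ covered m x a (toℕ j) ⟧) ≡ a
  sum-covered {x} {a} x<m a<m = +-cancelʳ-≡ n _ a (begin
    sum {m} (λ j → ⟦ covered m x a (toℕ j) ⟧) + n
      ≡⟨ cong (sum {m} (λ j → ⟦ covered m x a (toℕ j) ⟧) +_) (sum-target n) ⟨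
    sum {m} (λ j → ⟦ covered m x a (toℕ j) ⟧) + sum {m} (target n ∘ toℕ)
      ≡⟨ ∑-distrib-+ {m} (λ j → ⟦ covered m x a (toℕ j) ⟧) (target n ∘ toℕ) ⟨
    sum {m} (λ j → ⟦ covered m x a (toℕ j) ⟧ + target n (toℕ j))
      ≡⟨ sum-cong-≗ {m} (λ j → cong (λ y → ⟦ covered m y a (toℕ j) ⟧ + target n (toℕ j)) [a+n]%m≡x) ⟨
    sum {m} (λ j → ⟦ covered m ((a + n) % m) a (toℕ j) ⟧ + target n (toℕ j))
      ≡⟨ sum-cong-≗ {m} (λ j → target-+ n a<m (toℕ<n j)) ⟨
    sum {m} (target (a + n) ∘ toℕ)
      ≡⟨ sum-target (a + n) ⟩
    a + n ∎)
    where
    open ≡-Reasoning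
    -- Chosen so that `a + n = x + m`, which has residue `x`; the summand `m` keeps the subtraction
    -- from truncating.
    n : ℕ
    n = x + m ∸ a
    [a+n]%m≡x : (a + n) % m ≡ x
    [a+n]%m≡x = n<m+m⇒n%m m x<m (m+[n∸m]≡n (≤-trans (<⇒≤ a<m) (m≤n+m m x)))

-- Words as descending paths

after : ∀ {N} → (Fin N → ℕ) → Fin N → ℕ
after w zero    = sum (w ∘ suc)
after w (suc s) = after (w ∘ suc) s

-- Heights of the path before (from) and after (after) step s.
from : ∀ {N} → (Fin N → ℕ) → Fin N → ℕ
from w s = w s + after w s

after-last⊎next : ∀ {N} (w : Fin N → ℕ) s →
                  after w s ≡ 0 ⊎ ∃ λ s′ → toℕ s′ ≡ suc (toℕ s) × after w s ≡ from w s′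
after-last⊎next {suc zero}    w zero = inj₁ refl
after-last⊎next {suc (suc N)} w zero = inj₂ (suc zero , refl , refl)
after-last⊎next {suc N}       w (suc s) with after-last⊎next (w ∘ suc) s
... | inj₁ last            = inj₁ last
... | inj₂ (s′ , eq , eq′) = inj₂ (suc s′ , cong suc eq , eq′)

-- The height before step `s` is the total minus the earlier letters.
from-cong : ∀ {N} {w w′ : Fin N → ℕ} → sum w ≡ sum w′ → ∀ s →
            (∀ s′ → toℕ s′ < toℕ s → w s′ ≡ w′ s′) → from w s ≡ from w′ s
from-cong Σ≡ zero    _    = Σ≡
from-cong {w = w} {w′} Σ≡ (suc s) w≡w′ =
  from-cong (+-cancelˡ-≡ (w zero) _ _ (trans Σ≡ (cong (_+ sum (w′ ∘ suc)) (sym (w≡w′ zero z<s)))))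
            s (λ s′ s′<s → w≡w′ (suc s′) (s≤s s′<s))

-- The path |w| , |w| - w₀ , |w| - w₀ - w₁ , … , 0 covers each of 1 , … , |w| once.
sum-path : ∀ {m} .{{_ : NonZero m}} {N} (w : Fin N → ℕ) → (∀ s → w s < m) → ∀ {j} → j < m →
           sum (λ s → ⟦ covered m (from w s % m) (w s) j ⟧) ≡ target {m} (sum w) j
sum-path {m} {zero}  w w<m {j} j<m = sym (trans (target-unique {m} 0 j (≤-<-trans z≤n j<m) refl) (quota-00 j))
  where
  quota-00 : ∀ j → quota 0 0 j ≡ 0
  quota-00 zero    = refl
  quota-00 (suc j) = refl
sum-path {m} {suc N} w w<m {j} j<m = sym (trans (target-+ (sum (w ∘ suc)) (w<m zero) j<m)
  (cong (⟦ covered m (sum w % m) (w zero) j ⟧ +_) (sym (sum-path (w ∘ suc) (w<m ∘ suc) j<m))))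

-- Closure of equitable partitions under pointwise minimum and maximum

module ⊓ {m : ℕ} where
  open Min (Fin.≤-totalOrder m) public using (_⊓_)
  open Max (Fin.≤-totalOrder m) public using (_⊔_)
  open MinMaxOp (Min.minOperator (Fin.≤-totalOrder m)) (Max.maxOperator (Fin.≤-totalOrder m)) public

open ⊓ using (_⊓_; _⊔_)

≤⊔⇒≤⊎≤ : ∀ {m k} {x y : Fin m} → k ≤ toℕ (x ⊔ y) → k ≤ toℕ x ⊎ k ≤ toℕ y
≤⊔⇒≤⊎≤ {k = k} {x} {y} k≤ with ⊓.⊔-sel x y
... | inj₁ eq = inj₁ (subst (λ z → k ≤ toℕ z) eq k≤)
... | inj₂ eq = inj₂ (subst (λ z → k ≤ toℕ z) eq k≤)

module _ {m N : ℕ} .{{_ : NonZero m}} where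

  entry : Word m N → Blocks m N → Fin m → Fin N → ℕ
  entry u b j i = ⟦ covered m (toℕ (b i)) (toℕ (u i)) (toℕ j) ⟧

  Balanced : Word m N → Blocks m N → Set
  Balanced u b = ∀ j → sum (entry u b j) ≡ target {m} (sum (toℕ ∘ u)) (toℕ j)

  equitable⇒balanced : ∀ {u b} → IsEquitablePartition u b → Balanced u b
  equitable⇒balanced {u} {b} (_ , eq) j rewrite sym (sum-list≡sum (toℕ ∘ u))
    with 1 ≤? toℕ j | toℕ j ≤? weight u % m
  ... | yes p | yes q = trans (sym (sum-list≡sum (entry u b j)))
    (trans (proj₁ (eq j) (p , q)) (sym (quota-in p q)))
  ... | no ¬p | _     = trans (sym (sum-list≡sum (entry u b j)))
    (trans (proj₂ (eq j) (¬p ∘ proj₁)) (sym (quota-out (¬p ∘ proj₁))))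
  ... | _     | no ¬q = trans (sym (sum-list≡sum (entry u b j)))
    (trans (proj₂ (eq j) (¬q ∘ proj₂)) (sym (quota-out (¬q ∘ proj₂))))

  balanced⇒equitable : ∀ {u b} → IsPartitionedWord b → Balanced u b → IsEquitablePartition u b
  balanced⇒equitable {u} {b} part bal = part , λ j →
      (λ (p , q) → trans (count j) (quota-in p q)) , (λ ¬pq → trans (count j) (quota-out ¬pq))
    where
    count : ∀ j → columnCount u b j ≡ target {m} (weight u) (toℕ j)
    count j = trans (sum-list≡sum (entry u b j))
      (trans (bal j) (cong (λ n → target {m} n (toℕ j)) (sym (sum-list≡sum (toℕ ∘ u)))))

  equitable-cong : ∀ {u u′ b b′} → u ≗ u′ → b ≗ b′ → IsEquitablePartition u b → IsEquitablePartition u′ b′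
  equitable-cong {u} {u′} {b} {b′} u≗u′ b≗b′ eq = balanced⇒equitable
    (λ i i′ i≤i′ → subst₂ _≤_ (cong toℕ (b≗b′ i′)) (cong toℕ (b≗b′ i)) (proj₁ eq i i′ i≤i′))
    (λ j → begin
      sum (entry u′ b′ j)                  ≡⟨ sum-cong-≗ (λ i → cong₂ (cell j) (b≗b′ i) (u≗u′ i)) ⟨
      sum (entry u b j)                    ≡⟨ equitable⇒balanced eq j ⟩
      target {m} (sum (toℕ ∘ u)) (toℕ j)   ≡⟨ cong (λ n → target {m} n (toℕ j)) (sum-cong-≗ (cong toℕ ∘ u≗u′)) ⟩
      target {m} (sum (toℕ ∘ u′)) (toℕ j)  ∎)
    where
    open ≡-Reasoning
    cell : Fin m → Fin m → Fin m → ℕ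
    cell j x a = ⟦ covered m (toℕ x) (toℕ a) (toℕ j) ⟧

  -- Row `i` has `u i` filled entries whatever its block, so the number of filled entries does not
  -- depend on `b`.
  sum-entry : ∀ u b → sum (λ j → sum (entry u b j)) ≡ sum (toℕ ∘ u)
  sum-entry u b = trans (∑-comm (entry u b)) (sum-cong-≗ (λ i → sum-covered {m} (toℕ<n (b i)) (toℕ<n (u i))))

  entry-mono : ∀ u b e j i →
               (Covers m (toℕ (b i)) (toℕ (u i)) (toℕ j) → Covers m (toℕ (e i)) (toℕ (u i)) (toℕ j)) →
               entry u b j i ≤ entry u e j i
  entry-mono u b e j i b⇒e = ⟦⟧-mono
    (Covers⇒covered m (toℕ<n (e i)) (toℕ<n j) ∘ b⇒e ∘ covered⇒Covers m (toℕ<n (b i)) (toℕ<n (u i)))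

  -- Both column sums add up to |u|, so comparability in every column forces equality.
  balanced-≤ : ∀ {u b f} → Balanced u b → (∀ j → sum (entry u f j) ≤ sum (entry u b j)) → Balanced u f
  balanced-≤ {u} {b} {f} bal f≤b j =
    trans (≤∧sum≡⇒≗ f≤b (trans (sum-entry u f) (sym (sum-entry u b))) j) (bal j)

  balanced-≥ : ∀ {u b f} → Balanced u b → (∀ j → sum (entry u b j) ≤ sum (entry u f j)) → Balanced u f
  balanced-≥ {u} {b} {f} bal b≤f j =
    trans (sym (≤∧sum≡⇒≗ b≤f (trans (sum-entry u b) (sym (sum-entry u f))) j)) (bal j)

  nested : ∀ {b e : Blocks m N} → IsPartitionedWord b → IsPartitionedWord e → ∀ k →
           (∀ i → k ≤ toℕ (e i) → k ≤ toℕ (b i)) ⊎ (∀ i → k ≤ toℕ (b i) → k ≤ toℕ (e i))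
  nested {b} {e} b-part e-part k with any? (λ i → (k ≤? toℕ (e i)) ×-dec (toℕ (b i) <? k))
  ... | no  none = inj₁ λ i k≤e → ≮⇒≥ λ b<k → none (i , k≤e , b<k)
  -- Position `i₀` is in the segment of `e` but not in that of `b`, so the whole segment of `b` lies
  -- to its left.
  ... | yes (i₀ , k≤e , b<k) = inj₂ λ i k≤b →
    ≤-trans k≤e (e-part i i₀ (≮⇒≥ λ i₀<i → <⇒≱ b<k (≤-trans k≤b (b-part i₀ i (<⇒≤ i₀<i)))))

  infixl 7 _⊓ᵇ_
  infixl 6 _⊔ᵇ_

  _⊓ᵇ_ _⊔ᵇ_ : Op₂ (Blocks m N)
  (b ⊓ᵇ e) i = b i ⊓ e i
  (b ⊔ᵇ e) i = b i ⊔ e i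

  ⊓-equitable : ∀ {u b e} → IsEquitablePartition u b → IsEquitablePartition u e →
                IsEquitablePartition u (b ⊓ᵇ e)
  ⊓-equitable {u} {b} {e} eqᵇ eqᵉ = balanced⇒equitable
    (λ i i′ i≤i′ → ⊓.⊓-mono-≤ (proj₁ eqᵇ i i′ i≤i′) (proj₁ eqᵉ i i′ i≤i′))
    (balanced-≥ {u} {b} (equitable⇒balanced eqᵇ) column)
    where
    column : ∀ j → sum (entry u b j) ≤ sum (entry u (b ⊓ᵇ e) j)
    column j with nested (proj₁ eqᵇ) (proj₁ eqᵉ) (toℕ j)
    -- The minimum is compared with the operand having the smaller segment: none of its letters
    -- drops from a block at least `j` to one below `j`. The two operands have equal column sums.
    ... | inj₁ e⊆b = ≤-trans (≤-reflexive (trans (equitable⇒balanced eqᵇ j) (sym (equitable⇒balanced eqᵉ j))))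
      (sum-mono-≤ λ i → entry-mono u e (b ⊓ᵇ e) j i (Covers-shift (⊓.x⊓y≤y (b i) (e i))
        λ (<j , j≤e) → <⇒≱ <j (⊓.⊓-glb (e⊆b i j≤e) j≤e)))
    ... | inj₂ b⊆e =
      sum-mono-≤ λ i → entry-mono u b (b ⊓ᵇ e) j i (Covers-shift (⊓.x⊓y≤x (b i) (e i))
        λ (<j , j≤b) → <⇒≱ <j (⊓.⊓-glb j≤b (b⊆e i j≤b)))

  ⊔-equitable : ∀ {u b e} → IsEquitablePartition u b → IsEquitablePartition u e →
                IsEquitablePartition u (b ⊔ᵇ e)
  ⊔-equitable {u} {b} {e} eqᵇ eqᵉ = balanced⇒equitable
    (λ i i′ i≤i′ → ⊓.⊔-mono-≤ (proj₁ eqᵇ i i′ i≤i′) (proj₁ eqᵉ i i′ i≤i′))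
    (balanced-≤ {u} {b} (equitable⇒balanced eqᵇ) column)
    where
    column : ∀ j → sum (entry u (b ⊔ᵇ e) j) ≤ sum (entry u b j)
    column j with nested (proj₁ eqᵇ) (proj₁ eqᵉ) (toℕ j)
    ... | inj₁ e⊆b =
      sum-mono-≤ λ i → entry-mono u (b ⊔ᵇ e) b j i (Covers-shift (⊓.x≤x⊔y (b i) (e i))
        λ (<j , j≤⊔) → <⇒≱ <j ([ id , e⊆b i ]′ (≤⊔⇒≤⊎≤ j≤⊔)))
    ... | inj₂ b⊆e = ≤-trans
      (sum-mono-≤ λ i → entry-mono u (b ⊔ᵇ e) e j i (Covers-shift (⊓.x≤y⊔x (b i) (e i))
        λ (<j , j≤⊔) → <⇒≱ <j ([ b⊆e i , id ]′ (≤⊔⇒≤⊎≤ j≤⊔))))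
      (≤-reflexive (trans (equitable⇒balanced eqᵉ j) (sym (equitable⇒balanced eqᵇ j))))

-- Pigeonhole principle and sorting by an injective key

-- Deleting a missed value would give an injection of `Fin (suc n)` into `Fin n`.
injective⇒surjective : ∀ {n} {f : Fin n → Fin n} → Injective _≡_ _≡_ f → ∀ y → ∃ λ x → f x ≡ y
injective⇒surjective {suc n} {f} f-inj y with any? (λ x → f x Fin.≟ y)
... | yes hit  = hit
... | no  miss = contradiction
  (Fin.injective⇒≤ (f-inj ∘ Fin.punchOut-injective (y≢f _) (y≢f _)))
  1+n≰n
  where
  y≢f : ∀ x → y ≢ f x
  y≢f x y≡fx = miss (x , sym y≡fx)

module Ranking {N : ℕ} (key : Fin N → ℕ) (key-injective : Injective _≡_ _≡_ key) where

  below : Fin N → Fin N → Bool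
  below s s′ = key s′ <ᵇ key s

  below-irrefl : ∀ s → ⟦ below s s ⟧ ≡ 0
  below-irrefl s = ⟦⟧-false (<-irrefl refl ∘ <ᵇ⇒< (key s) (key s))

  sum-below<N : ∀ s → sum (⟦_⟧ ∘ below s) < N
  sum-below<N s = subst (sum (⟦_⟧ ∘ below s) <_) (sum-1 N)
    (sum-mono-< {g = λ _ → 1} (λ s′ → ⟦⟧-mono {c = true} _) s (s≤s (≤-reflexive (below-irrefl s))))
    where
    sum-1 : ∀ n → sum {n} (λ _ → 1) ≡ n
    sum-1 zero    = refl
    sum-1 (suc n) = cong suc (sum-1 n)

  rank : Fin N → Fin N
  rank s = fromℕ< (sum-below<N s)

  -- Everything below `s` is below `s′`, and `s` itself is counted only for `s′`.
  rank-mono-< : ∀ {s s′} → key s < key s′ → toℕ (rank s) < toℕ (rank s′)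
  rank-mono-< {s} {s′} k<k′ = subst₂ _<_
    (sym (toℕ-fromℕ< (sum-below<N s))) (sym (toℕ-fromℕ< (sum-below<N s′)))
    (sum-mono-< (λ t → ⟦⟧-mono λ t<s → <⇒<ᵇ (<-trans (<ᵇ⇒< (key t) (key s) t<s) k<k′)) s
      (subst₂ _<_ (sym (below-irrefl s)) (sym (⟦⟧-true (<⇒<ᵇ k<k′))) z<s))

  rank-injective : Injective _≡_ _≡_ rank
  rank-injective {s} {s′} eq with <-cmp (key s) (key s′)
  ... | tri< k<k′ _ _ = contradiction (rank-mono-< k<k′) (<-irrefl (cong toℕ eq))
  ... | tri≈ _ k≡k′ _ = key-injective k≡k′
  ... | tri> _ _ k>k′ = contradiction (rank-mono-< k>k′) (<-irrefl (cong toℕ (sym eq)))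

  unrank : Fin N → Fin N
  unrank i = proj₁ (injective⇒surjective rank-injective i)

  rank-unrank : ∀ i → rank (unrank i) ≡ i
  rank-unrank i = proj₂ (injective⇒surjective rank-injective i)

  unrank-rank : ∀ s → unrank (rank s) ≡ s
  unrank-rank s = rank-injective (rank-unrank (rank s))

  unranking : Permutation′ N
  unranking = permutation unrank rank unrank-rank rank-unrank

-- The sweep map and its equitable partition

module Sweep {m N : ℕ} .{{_ : NonZero m}} (w : Word m N) where

  level : Fin N → Fin m
  level s = fromℕ< (m%n<n (from (toℕ ∘ w) s) m)

  toℕ-level : ∀ s → toℕ (level s) ≡ from (toℕ ∘ w) s % m
  toℕ-level s = toℕ-fromℕ< (m%n<n (from (toℕ ∘ w) s) m)

  -- Lexicographic: larger levels first, then earlier steps first.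
  key : Fin N → ℕ
  key s = toℕ (combine (opposite (level s)) s)

  key-injective : Injective _≡_ _≡_ key
  key-injective {s} {s′} = Fin.combine-injectiveʳ (opposite (level s)) s (opposite (level s′)) s′ ∘ toℕ-injective

  open Ranking key key-injective public

  level-<⇒rank-> : ∀ {s s′} → toℕ (level s) < toℕ (level s′) → toℕ (rank s′) < toℕ (rank s)
  level-<⇒rank-> {s} {s′} lt = rank-mono-< (Fin.combine-monoˡ-< s′ s
    (subst₂ _<_ (sym (Fin.opposite-prop (level s′))) (sym (Fin.opposite-prop (level s)))
      (∸-monoʳ-< (s≤s lt) (toℕ<n (level s′)))))

  level-≡⇒rank-< : ∀ {s s′} → level s ≡ level s′ → toℕ s < toℕ s′ → toℕ (rank s) < toℕ (rank s′)
  level-≡⇒rank-< {s} {s′} eq lt = rank-mono-< (subst₂ _<_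
    (sym (Fin.toℕ-combine (opposite (level s)) s))
    (trans (cong (λ l → N * toℕ (opposite l) + toℕ s′) eq) (sym (Fin.toℕ-combine (opposite (level s′)) s′)))
    (+-monoʳ-< (N * toℕ (opposite (level s))) lt))

  sweep : Word m N
  sweep = w ∘ unrank

  sweepBlocks : Blocks m N
  sweepBlocks = level ∘ unrank

  sum-sweep : sum (toℕ ∘ w) ≡ sum (toℕ ∘ sweep)
  sum-sweep = sum-permute (toℕ ∘ w) unranking

  sweep-partitioned : IsPartitionedWord sweepBlocks
  sweep-partitioned i i′ i≤i′ = ≮⇒≥ λ lt →
    <⇒≱ (subst₂ _<_ (cong toℕ (rank-unrank i′)) (cong toℕ (rank-unrank i)) (level-<⇒rank-> lt)) i≤i′

  -- Column sums ignore the order of the rows, so they can be computed along the path by `sum-path`.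
  sweep-equitable : IsEquitablePartition sweep sweepBlocks
  sweep-equitable = balanced⇒equitable sweep-partitioned λ j → begin
    sum (entry sweep sweepBlocks j)
      ≡⟨ sum-permute (entry w level j) unranking ⟨
    sum (entry w level j)
      ≡⟨ sum-cong-≗ (λ s → cong (λ x → ⟦ covered m x (toℕ (w s)) (toℕ j) ⟧) (toℕ-level s)) ⟩
    sum (λ s → ⟦ covered m (from (toℕ ∘ w) s % m) (toℕ (w s)) (toℕ j) ⟧)
      ≡⟨ sum-path (toℕ ∘ w) (toℕ<n ∘ w) (toℕ<n j) ⟩
    target {m} (sum (toℕ ∘ w)) (toℕ j)
      ≡⟨ cong (λ n → target {m} n (toℕ j)) sum-sweep ⟩
    target {m} (sum (toℕ ∘ sweep)) (toℕ j) ∎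
    where open ≡-Reasoning

  -- The sweep partition is rightmost

  module _ {e : Blocks m N} (e-eq : IsEquitablePartition sweep e)
           (e≤level : ∀ s → toℕ (e (rank s)) ≤ toℕ (level s)) where

    -- Backwards along the path: the step after s leaves column v, where s ends.
    -- No letter is moved from a block ≥ v to a block < v, so e fills at least
    -- what the sweep fills in column v, hence exactly that; but moving s down
    -- would make it cover v.
    fixed : ∀ s → Acc Data.Fin._>_ s → e (rank s) ≡ level s
    fixed s (acc rs) = toℕ-injective (≤-antisym (e≤level s) (≮⇒≥ λ moved →
        uncovered (covered⇒Covers m (toℕ<n (level s)) (toℕ<n (w s))
          (same-column (Covers⇒covered m (toℕ<n (e (rank s))) v<m (covers moved))))))
      where
      n : ℕ
      n = after (toℕ ∘ w) s
      v : ℕ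
      v = n % m
      v<m : v < m
      v<m = m%n<n n m
      a : ℕ
      a = toℕ (w s)

      later-fixed : ∀ {s′} → toℕ s < toℕ s′ → e (rank s′) ≡ level s′
      later-fixed s<s′ = fixed _ (rs s<s′)

      -- At the end of the path `v` is 0. Otherwise the next step `s′` starts at level `v` and keeps
      -- its block. Steps ranked up to `s′` stay in blocks at least `v` since `e` is weakly
      -- decreasing; a step ranked later with level at least `v` has level `v` and comes later in
      -- time, so it is fixed too.
      no-crossing : ∀ t → ¬ (toℕ (e (rank t)) < v × v ≤ toℕ (level t))
      no-crossing t (e<v , v≤level) with after-last⊎next (toℕ ∘ w) s
      ... | inj₁ n≡0 = n≮0 (subst (toℕ (e (rank t)) <_)
        (trans (cong (_% m) n≡0) (m<n⇒m%n≡m (≤-<-trans z≤n v<m))) e<v)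
      ... | inj₂ (s′ , s′≡1+s , n≡from) =
        go (<-cmp (toℕ (level s′)) (toℕ (level t))) (<-cmp (toℕ t) (toℕ s′))
        where
        s<s′ : toℕ s < toℕ s′
        s<s′ = ≤-reflexive (sym s′≡1+s)
        v≡level : v ≡ toℕ (level s′)
        v≡level = trans (cong (_% m) n≡from) (sym (toℕ-level s′))
        v≡e : v ≡ toℕ (e (rank s′))
        v≡e = trans v≡level (cong toℕ (sym (later-fixed s<s′)))
        after-s′ : ¬ toℕ (rank t) ≤ toℕ (rank s′)
        after-s′ le = <⇒≱ e<v (subst (_≤ toℕ (e (rank t))) (sym v≡e) (proj₁ e-eq (rank t) (rank s′) le))
        go : _ → _ → _
        go (tri< lt _ _) _             = after-s′ (<⇒≤ (level-<⇒rank-> lt))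
        go (tri≈ _ eq _) (tri< lt _ _) = after-s′ (<⇒≤ (level-≡⇒rank-< (sym (toℕ-injective eq)) lt))
        go (tri≈ _ eq _) (tri≈ _ t≡ _) = after-s′ (≤-reflexive (cong (toℕ ∘ rank) (toℕ-injective t≡)))
        go (tri≈ _ eq _) (tri> _ _ gt) = <⇒≱ e<v
          (subst (v ≤_) (cong toℕ (sym (later-fixed (<-trans s<s′ gt)))) v≤level)
        go (tri> _ _ gt) _             = <⇒≱ gt (subst (_≤ toℕ (level t)) v≡level v≤level)

      vᶠ : Fin m
      vᶠ = fromℕ< v<m

      column : ∀ i → entry sweep sweepBlocks vᶠ i ≡ entry sweep e vᶠ i
      column = ≤∧sum≡⇒≗
        (λ i → entry-mono sweep sweepBlocks e vᶠ i (Covers-shift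
          (subst (λ k → toℕ (e k) ≤ toℕ (sweepBlocks i)) (rank-unrank i) (e≤level (unrank i)))
          λ (<v , v≤) → no-crossing (unrank i)
            ( subst₂ (λ k x → toℕ (e k) < x) (sym (rank-unrank i)) (toℕ-fromℕ< v<m) <v
            , subst (_≤ toℕ (sweepBlocks i)) (toℕ-fromℕ< v<m) v≤)))
        (trans (equitable⇒balanced sweep-equitable vᶠ) (sym (equitable⇒balanced e-eq vᶠ)))

      same-column : T (covered m (toℕ (e (rank s))) a v) → T (covered m (toℕ (level s)) a v)
      same-column = ⟦⟧-reflects (subst₂
        (λ t x → ⟦ covered m (toℕ (level t)) (toℕ (w t)) x ⟧
               ≡ ⟦ covered m (toℕ (e (rank s))) (toℕ (w t)) x ⟧)
        (unrank-rank s) (toℕ-fromℕ< v<m) (column (rank s)))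

      ends-at-v : (v + a < m × toℕ (level s) ≡ v + a) ⊎ (v + a ≡ toℕ (level s) + m)
      ends-at-v = subst (λ x → (v + a < m × x ≡ v + a) ⊎ (v + a ≡ x + m)) (sym (toℕ-level s))
        ([a+n]%m n (toℕ<n (w s)))

      -- The step stops just above `v`, and being shorter than `m` it does not come round to `v`.
      uncovered : ¬ Covers m (toℕ (level s)) a v
      uncovered c with ends-at-v | c
      ... | inj₁ (_ , eq) | inj₁ (_ , lt) = <-irrefl eq lt
      ... | inj₁ (_ , eq) | inj₂ (lt , _) = <⇒≱ lt (subst (v ≤_) (sym eq) (m≤m+n v a))
      ... | inj₂ eq       | inj₁ (le , _) = <⇒≱ (wrap-<ˡ (toℕ<n (w s)) eq) le
      ... | inj₂ eq       | inj₂ (_ , lt) = <-irrefl (sym eq) lt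

      -- The same length from a lower start overshoots `v`. If the original step does not wrap,
      -- `no-crossing` keeps the new start at or above `v`.
      covers : toℕ (e (rank s)) < toℕ (level s) → Covers m (toℕ (e (rank s))) a v
      covers moved with ends-at-v
      ... | inj₁ (_ , eq) = inj₁
        ( ≮⇒≥ (λ e<v → no-crossing s (e<v , subst (v ≤_) (sym eq) (m≤m+n v a)))
        , subst (toℕ (e (rank s)) <_) eq moved)
      ... | inj₂ eq = inj₂
        ( <-trans moved (wrap-<ˡ (toℕ<n (w s)) eq)
        , subst (toℕ (e (rank s)) + m <_) (sym eq) (+-monoˡ-< m moved))

  sweep-rightmost : ∀ {e} → IsEquitablePartition sweep e → ∀ i → toℕ (sweepBlocks i) ≤ toℕ (e i)
  sweep-rightmost {e} e-eq i = subst (_≤ toℕ (e i)) (cong toℕ f≡) (⊓.x⊓y≤x (e i) (sweepBlocks i))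
    where
    f : Blocks m N
    f = e ⊓ᵇ sweepBlocks
    f≡ : f i ≡ sweepBlocks i
    f≡ = trans (cong f (sym (rank-unrank i))) (fixed (⊓-equitable e-eq sweep-equitable)
      (λ s → subst (λ t → toℕ (f (rank s)) ≤ toℕ (level t)) (unrank-rank s)
        (⊓.x⊓y≤y (e (rank s)) (sweepBlocks (rank s))))
      (unrank i) (>-wellFounded (unrank i)))

-- Injectivity of the sweep map

module _ {m N : ℕ} .{{_ : NonZero m}} where

  open Sweep {m} {N} using (sweep; sweepBlocks; level; sum-sweep; sweep-equitable; sweep-rightmost)

  module _ {w w′ : Word m N} (same : sweep w ≗ sweep w′) where
    private
      module S  = Sweep w
      module S′ = Sweep w′

    -- Both are the rightmost equitable partition of the same word.
    sweepBlocks-unique : sweepBlocks w ≗ sweepBlocks w′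
    sweepBlocks-unique i = toℕ-injective (≤-antisym
      (sweep-rightmost w (equitable-cong (sym ∘ same) (λ _ → refl) (sweep-equitable w′)) i)
      (sweep-rightmost w′ (equitable-cong same (λ _ → refl) (sweep-equitable w)) i))

    letters-agree : ∀ {s} → S.rank s ≡ S′.rank s → w s ≡ w′ s
    letters-agree {s} eq = begin
      w s                  ≡⟨ cong w (S.unrank-rank s) ⟨
      sweep w (S.rank s)   ≡⟨ same (S.rank s) ⟩
      sweep w′ (S.rank s)  ≡⟨ cong (sweep w′) eq ⟩
      sweep w′ (S′.rank s) ≡⟨ cong w′ (S′.unrank-rank s) ⟩
      w′ s                 ∎
      where open ≡-Reasoning

    levels-agree : ∀ {s} → (∀ s′ → toℕ s′ < toℕ s → S.rank s′ ≡ S′.rank s′) →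
                   level w s ≡ level w′ s
    levels-agree {s} before = toℕ-injective (begin
      toℕ (level w s)           ≡⟨ S.toℕ-level s ⟩
      from (toℕ ∘ w) s % m      ≡⟨ cong (_% m) (from-cong sum≡ s (λ s′ → cong toℕ ∘ letters-agree ∘ before s′)) ⟩
      from (toℕ ∘ w′) s % m     ≡⟨ S′.toℕ-level s ⟨
      toℕ (level w′ s)          ∎)
      where
      open ≡-Reasoning
      sum≡ : sum (toℕ ∘ w) ≡ sum (toℕ ∘ w′)
      sum≡ = trans (sum-sweep w) (trans (sum-cong-≗ (cong toℕ ∘ same)) (sym (sum-sweep w′)))

    -- In a given block the path uses the letters from left to right.
    rank-≮ : ∀ {s} → (∀ s′ → toℕ s′ < toℕ s → S.rank s′ ≡ S′.rank s′) →
             ¬ toℕ (S.rank s) < toℕ (S′.rank s)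
    rank-≮ {s} before lt with <-cmp (toℕ t) (toℕ s)
      where
      -- The step of the second path at the position that the first path uses at time `s`. If `t`
      -- were earlier, the first path would already have used this position; if later, the equal
      -- levels would force `S′.rank s` below `S.rank s`.
      t : Fin N
      t = S′.unrank (S.rank s)
    ... | tri< t<s _ _ = <-irrefl
      (cong toℕ (S.rank-injective (trans (before _ t<s) (S′.rank-unrank (S.rank s))))) t<s
    ... | tri≈ _ t≡s _ = <-irrefl
      (cong toℕ (trans (sym (S′.rank-unrank (S.rank s))) (cong S′.rank (toℕ-injective t≡s)))) lt
    ... | tri> _ _ s<t = <-asym lt (subst (λ i → toℕ (S′.rank s) < toℕ i) (S′.rank-unrank (S.rank s))
      (S′.level-≡⇒rank-< (begin
        level w′ s                  ≡⟨ levels-agree before ⟨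
        level w s                   ≡⟨ cong (level w) (S.unrank-rank s) ⟨
        sweepBlocks w (S.rank s)    ≡⟨ sweepBlocks-unique (S.rank s) ⟩
        sweepBlocks w′ (S.rank s)   ∎) s<t))
      where open ≡-Reasoning

  sweep-injective : ∀ {w w′ : Word m N} → sweep w ≗ sweep w′ → w ≗ w′
  sweep-injective {w} {w′} same s = letters-agree same (rank≡ s (<-wellFounded s))
    where
    rank≡ : ∀ s → Acc Data.Fin._<_ s → Sweep.rank w s ≡ Sweep.rank w′ s
    rank≡ s (acc rs) = toℕ-injective (≤-antisym
      (≮⇒≥ (rank-≮ (sym ∘ same) λ s′ s′<s → sym (rank≡ s′ (rs s′<s))))
      (≮⇒≥ (rank-≮ same λ s′ s′<s → rank≡ s′ (rs s′<s))))

  -- Surjectivity of the sweep map by counting words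

  decode : Fin (m ^ N) → Word m N
  decode = finToFun {m} {N}

  encode : Word m N → Fin (m ^ N)
  encode = funToFin {N} {m}

  decode-encode : ∀ w → decode (encode w) ≗ w
  decode-encode w = Fin.finToFun-funToFin w

  encode-cong : ∀ {w w′} → w ≗ w′ → encode w ≡ encode w′
  encode-cong = funToFin-cong
    where
    funToFin-cong : ∀ {n} {f g : Fin n → Fin m} → f ≗ g → funToFin f ≡ funToFin g
    funToFin-cong {zero}  f≗g = refl
    funToFin-cong {suc n} f≗g = cong₂ combine (f≗g zero) (funToFin-cong (f≗g ∘ suc))

  encode-injective : ∀ {w w′} → encode w ≡ encode w′ → w ≗ w′
  encode-injective {w} {w′} eq i =
    trans (sym (decode-encode w i)) (trans (cong (λ x → decode x i) eq) (decode-encode w′ i))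

  decode-injective : ∀ {x y} → decode x ≗ decode y → x ≡ y
  decode-injective {x} {y} eq = trans (sym (Fin.funToFin-finToFin {N} {m} x))
    (trans (encode-cong eq) (Fin.funToFin-finToFin {N} {m} y))

  sweep-surjective : ∀ u → ∃ λ w → sweep w ≗ u
  sweep-surjective u = decode (proj₁ hit) , encode-injective (proj₂ hit)
    where
    code-injective : Injective _≡_ _≡_ (encode ∘ sweep ∘ decode)
    code-injective {x} {y} eq = decode-injective (sweep-injective {decode x} {decode y} (encode-injective eq))
    hit : ∃ λ x → encode (sweep (decode x)) ≡ encode u
    hit = injective⇒surjective code-injective (encode u)

  -- Existence of the rightmost and leftmost equitable partitions

  rightmost : ∀ u → Σ (EqPart u) (IsRightmost u)
  rightmost u =
    ( sweepBlocks w
    , equitable-cong {u = sweep w} {u} {sweepBlocks w} {sweepBlocks w} sw≗u (λ _ → refl) (sweep-equitable w))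
    , λ (v , v-eq) i → sweep-rightmost w {v}
        (equitable-cong {u = u} {sweep w} {v} {v} (sym ∘ sw≗u) (λ _ → refl) v-eq) i
    where
    w : Word m N
    w = proj₁ (sweep-surjective u)
    sw≗u : sweep w ≗ u
    sw≗u = proj₂ (sweep-surjective u)

  isEquitable? : ∀ u b → Dec (IsEquitablePartition {m} {N} u b)
  isEquitable? u b =
    all? (λ i → all? λ i′ → (i Fin.≤? i′) →-dec (b i′ Fin.≤? b i))
    ×-dec all? λ j →
      let in? = (1 ≤? toℕ j) ×-dec (toℕ j ≤? weight u % m) in
      (in? →-dec (columnCount u b j ≟ suc (weight u / m)))
      ×-dec (¬? in? →-dec (columnCount u b j ≟ weight u / m))

  -- Members of the family that are not equitable are skipped; `e` is the value for the empty
  -- family.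
  ⊔-fold : ∀ {u} → EqPart u → ∀ {k} (f : Fin k → Blocks m N) →
           ∃ λ (l : EqPart u) →
             ∀ x → IsEquitablePartition u (f x) → ∀ i → toℕ (f x i) ≤ toℕ (proj₁ l i)
  ⊔-fold e {zero}  f = e , λ ()
  ⊔-fold {u} e {suc k} f with ⊔-fold e (f ∘ suc) | isEquitable? u (f zero)
  ... | l , ub | no ¬eq = l , λ { zero eq → contradiction eq ¬eq ; (suc x) → ub x }
  ... | (l , l-eq) , ub | yes eq = (f zero ⊔ᵇ l , ⊔-equitable eq l-eq) , λ
    { zero    _     i → ⊓.x≤x⊔y (f zero i) (l i)
    ; (suc x) fx-eq i → ≤-trans (ub x fx-eq i) (⊓.x≤y⊔x (f zero i) (l i)) }

  leftmost : ∀ (u : Word m N) → Σ (EqPart u) (IsLeftmost u)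
  leftmost u = proj₁ top , λ (v , v-eq) i →
    subst (λ x → toℕ x ≤ toℕ (proj₁ (proj₁ top) i)) (decode-encode v i)
      (proj₂ top (encode v) (equitable-cong {u = u} {u} {v} {decode (encode v)}
        (λ _ → refl) (sym ∘ decode-encode v) v-eq) i)
    where
    top : ∃ λ (l : EqPart u) →
      ∀ x → IsEquitablePartition u (decode x) → ∀ i → toℕ (decode x i) ≤ toℕ (proj₁ l i)
    -- Block functions have the same type as words, so `decode` runs through all of them up to
    -- pointwise equality.
    top = ⊔-fold (proj₁ (rightmost u)) decode

  -- The distributive lattice

  -- u ≼ v means block v ≤ block u, so joins are minima of blocks and meets are maxima.
  _∨ₚ_ _∧ₚ_ : ∀ {u : Word m N} → Op₂ (EqPart u)
  (b , b-eq) ∨ₚ (e , e-eq) = b ⊓ᵇ e , ⊓-equitable b-eq e-eq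
  (b , b-eq) ∧ₚ (e , e-eq) = b ⊔ᵇ e , ⊔-equitable b-eq e-eq

  isDistributiveLattice : ∀ {u : Word m N} →
    IsDistributiveLattice (_≈ₚ_ {u = u}) (_≼_ {u = u}) (_∨ₚ_ {u = u}) (_∧ₚ_ {u = u})
  isDistributiveLattice = record
    { isLattice = record
      { isPartialOrder = record
        { isPreorder = record
          { isEquivalence = record
            { refl  = λ _ → refl
            ; sym   = λ e≈f i → sym (e≈f i)
            ; trans = λ e≈f f≈g i → trans (e≈f i) (f≈g i)
            }
          ; reflexive = λ e≈f i → ≤-reflexive (cong toℕ (sym (e≈f i)))
          ; trans     = λ e≼f f≼g i → ≤-trans (f≼g i) (e≼f i)
          }
        ; antisym = λ e≼f f≼e i → toℕ-injective (≤-antisym (f≼e i) (e≼f i))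
        }
      ; supremum = λ e f →
          (λ i → ⊓.x⊓y≤x (block e i) (block f i))
        , (λ i → ⊓.x⊓y≤y (block e i) (block f i))
        , λ g e≼g f≼g i → ⊓.⊓-glb (e≼g i) (f≼g i)
      ; infimum = λ e f →
          (λ i → ⊓.x≤x⊔y (block e i) (block f i))
        , (λ i → ⊓.x≤y⊔x (block e i) (block f i))
        , λ g g≼e g≼f i → ⊓.⊔-lub (g≼e i) (g≼f i)
      }
    ; ∧-distribˡ-∨ = λ e f g i → ⊓.⊔-distribˡ-⊓ (block e i) (block f i) (block g i)
    }

theorem5p8 : (m N : ℕ) .{{_ : NonZero m}} .{{_ : NonZero N}} (u : Word m N) →
    Σ (Op₂ (EqPart u)) (λ _∨_ → Σ (Op₂ (EqPart u)) (λ _∧_ →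
    IsDistributiveLattice _≈ₚ_ _≼_ _∨_ _∧_))
    × Σ (EqPart u) (λ l → IsLeftmost u l × Minimum _≼_ l)
    × Σ (EqPart u) (λ r → IsRightmost u r × Maximum _≼_ r)
theorem5p8 m N u =
    (_∨ₚ_ , _∧ₚ_ , isDistributiveLattice)
  -- By definition of `≼`, being leftmost and being the minimum are the same statement; likewise for
  -- rightmost and maximum.
  , (proj₁ (leftmost u) , proj₂ (leftmost u) , proj₂ (leftmost u))
  , (proj₁ (rightmost u) , proj₂ (rightmost u) , proj₂ (rightmost u))
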